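{- Let $\approx$ be the congruence on the set $\mathcal{T}$ of types generated by a family of recursive equations $X_i \approx F_i$ ($i\in I$), where $F_i \in \mathcal{T}$, and assume that $\approx$ is good. Then every $\lambda\mu$-term that is typable in the simply typed $\lambda\mu$-calculus modulo $\approx$ is strongly normalizing: if $\Gamma \vdash M : T$ for some context $\Gamma$ and some type $T$, then there is no infinite $\rhd$-reduction sequence starting from $M$.
   Context: Terms. Let $\mathcal{V}$ ($\lambda$-variables $x,y,\dots$) and $\mathcal{W}$ ($\mu$-variables $\alpha,\beta,\dots$) be disjoint infinite sets. $\lambda\mu$-terms are given by $\mathcal{M} ::= \mathcal{V} \mid \lambda \mathcal{V}\,\mathcal{M} \mid (\mathcal{M}\;\mathcal{M}) \mid \mu\mathcal{W}\,\mathcal{M} \mid (\mathcal{W}\;\mathcal{M})$, up to renaming of bound variables. The relation $\rhd$ is the least relation compatible with contexts containing $(\lambda x\, M\; N) \rhd M[x:=N]$ and $(\mu\alpha\,M\;N)\rhd\mu\alpha\,M[\alpha=N]$, where $M[\alpha=N]$ is obtained from $M$ by (recursively) replacing each subterm of the form $(\alpha\;P)$ by $(\alpha\;(P\;N))$. Types. Let $\mathcal{A}$ be a set of atomic constants containing the symbol $\bot$ and $\mathcal{X}=\{X_i : i\in I\}$ a set of type variables. Types are given by $\mathcal{T} ::= \mathcal{A} \mid \mathcal{X} \mid \mathcal{T}\to\mathcal{T}$; $\neg U$ denotes $U\to\bot$. Given types $F_i$ ($i\in I$), the congruence $\approx$ generated by $E=\{F_i : i\in I\}$ is the least congruence on $\mathcal{T}$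 (equivalence relation compatible with $\to$) such that $X_i\approx F_i$ for each $i\in I$. Polarity. For $X\in\mathcal{X}$, the sets $\mathcal{T}^+(X),\mathcal{T}^-(X)\subseteq\mathcal{T}$ are defined inductively by: $X\in\mathcal{T}^+(X)$; if $U\in(\mathcal{X}\setminus\{X\})\cup\mathcal{A}$ then $U\in\mathcal{T}^+(X)\cap\mathcal{T}^-(X)$; if $U\in\mathcal{T}^-(X)$ and $V\in\mathcal{T}^+(X)$, then $U\to V\in\mathcal{T}^+(X)$ and $V\to U\in\mathcal{T}^-(X)$. The congruence $\approx$ is good if, for each $X\in\mathcal{X}$ and each type $T$, $X\approx T$ implies $T\in\mathcal{T}^+(X)$. Typing rules ($\Gamma$ is a set of declarations $x:U$ and $\alpha:\neg U$): (ax) $\Gamma,x:U\vdash x:U$; ($\approx$) from $\Gamma\vdash M:U$ and $U\approx V$ infer $\Gamma\vdash M:V$; ($\to_i$) from $\Gamma,x:U\vdash M:V$ infer $\Gamma\vdash\lambda x\,M:U\to V$; ($\to_e$) from $\Gamma\vdash M_1:U\to V$ and $\Gamma\vdash M_2:U$ infer $\Gamma\vdash(M_1\;M_2):V$; ($\bot_e$) from $\Gamma,\alpha:\neg U\vdash M:\bot$ infer $\Gamma\vdash\mu\alpha\,M:U$; ($\bot_i$) from $\Gamma,\alpha:\neg U\vdash M:U$ infer $\Gamma,\alpha:\neg U\vdash(\alpha\;M):\bot$. -}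

module Defs where

open import Data.Bool using (if_then_else_)
open import Data.Fin using (Fin; zero; suc; lift; _≟_)
open import Data.Nat using (ℕ; zero; suc)
open import Data.Product using (∃-syntax)
open import Data.Vec using (Vec; _∷_; lookup)
open import Function using (flip; id)
open import Induction.InfiniteDescent using (InfiniteDescendingSequenceFrom)
open import Relation.Binary.PropositionalEquality using (_≢_)
open import Relation.Nullary using (¬_; does)

-- Terms up to renaming of bound variables: well-scoped de Bruijn terms with
-- (at most) m free λ-variables and n free μ-variables.  The two sorts of
-- variables are indexed separately: ƛ binds only a λ-variable, μ only a
-- μ-variable.  [ α ] M is the term written (α M) on paper.

infixl 7 _·_

data Term (m n : ℕ) : Set where
  var   : Fin m → Term m n
  ƛ_    : Term (suc m) n → Term m n
  _·_   : Term m n → Term m n → Term m n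
  μ_    : Term m (suc n) → Term m n
  [_]_  : Fin n → Term m n → Term m n

rename : ∀ {m m′ n n′} → (Fin m → Fin m′) → (Fin n → Fin n′) →
         Term m n → Term m′ n′
rename ρ τ (var x)   = var (ρ x)
rename ρ τ (ƛ M)     = ƛ rename (lift 1 ρ) τ M
rename ρ τ (M · N)   = rename ρ τ M · rename ρ τ N
rename ρ τ (μ M)     = μ rename ρ (lift 1 τ) M
rename ρ τ ([ α ] M) = [ τ α ] rename ρ τ M

weakenλ : ∀ {m n} → Term m n → Term (suc m) n
weakenλ = rename suc id

weakenμ : ∀ {m n} → Term m n → Term m (suc n)
weakenμ = rename id suc

extend : ∀ {m m′ n} → (Fin m → Term m′ n) → Fin (suc m) → Term (suc m′) n
extend σ zero    = var zero
extend σ (suc x) = weakenλ (σ x)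

substitute : ∀ {m m′ n} → (Fin m → Term m′ n) → Term m n → Term m′ n
substitute σ (var x)   = σ x
substitute σ (ƛ M)     = ƛ substitute (extend σ) M
substitute σ (M · N)   = substitute σ M · substitute σ N
substitute σ (μ M)     = μ substitute (λ x → weakenμ (σ x)) M
substitute σ ([ α ] M) = [ α ] substitute σ M

single : ∀ {m n} → Term m n → Fin (suc m) → Term m n
single N zero    = N
single N (suc x) = var x

-- M[x:=N], where x is the λ-variable of index 0 in M.
infix 8 _[0:=_]

_[0:=_] : ∀ {m n} → Term (suc m) n → Term m n → Term m n
M [0:= N ] = substitute (single N) M

-- M[α=N]: every subterm (α P) of M becomes (α (P[α=N] N)); α itself remains
-- a variable of the result.
infix 8 _[_=′_]

_[_=′_] : ∀ {m n} → Term m n → Fin n → Term m n → Term m n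
var x     [ α =′ N ] = var x
(ƛ M)     [ α =′ N ] = ƛ (M [ α =′ weakenλ N ])
(M₁ · M₂) [ α =′ N ] = M₁ [ α =′ N ] · M₂ [ α =′ N ]
(μ M)     [ α =′ N ] = μ (M [ suc α =′ weakenμ N ])
([ β ] M) [ α =′ N ] =
  [ β ] (if does (β ≟ α) then M [ α =′ N ] · N else M [ α =′ N ])

infix 4 _▷_

data _▷_ {m n : ℕ} : Term m n → Term m n → Set where
  βλ   : ∀ {M N} → (ƛ M) · N ▷ M [0:= N ]
  βμ   : ∀ {M N} → (μ M) · N ▷ μ (M [ zero =′ weakenμ N ])
  ξ-ƛ  : ∀ {M M′} → M ▷ M′ → ƛ M ▷ ƛ M′
  ξ-·ˡ : ∀ {M M′ N} → M ▷ M′ → M · N ▷ M′ · N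
  ξ-·ʳ : ∀ {M N N′} → N ▷ N′ → M · N ▷ M · N′
  ξ-μ  : ∀ {M M′} → M ▷ M′ → μ M ▷ μ M′
  ξ-[] : ∀ {α M M′} → M ▷ M′ → [ α ] M ▷ [ α ] M′

StronglyNormalizing : ∀ {m n} → Term m n → Set
StronglyNormalizing M = ¬ (∃[ f ] InfiniteDescendingSequenceFrom (flip _▷_) f M)

infixr 6 _⇒_

data Type (A I : Set) : Set where
  atom : A → Type A I
  tvar : I → Type A I
  _⇒_  : Type A I → Type A I → Type A I

-- The congruence generated by the equations tvar i ≈ F i.  A variable
-- subject to no proper equation is accommodated by taking F i = tvar i.
infix 4 _⊢_≈_

data _⊢_≈_ {A I : Set} (F : I → Type A I) : Type A I → Type A I → Set where
  ≈-eqn   : ∀ i → F ⊢ tvar i ≈ F i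
  ≈-refl  : ∀ {U} → F ⊢ U ≈ U
  ≈-sym   : ∀ {U V} → F ⊢ U ≈ V → F ⊢ V ≈ U
  ≈-trans : ∀ {U V W} → F ⊢ U ≈ V → F ⊢ V ≈ W → F ⊢ U ≈ W
  ≈-⇒     : ∀ {U U′ V V′} → F ⊢ U ≈ U′ → F ⊢ V ≈ V′ → F ⊢ U ⇒ V ≈ U′ ⇒ V′

mutual
  data Pos {A I : Set} (i : I) : Type A I → Set where
    self  : Pos i (tvar i)
    atom  : ∀ {a} → Pos i (atom a)
    other : ∀ {j} → j ≢ i → Pos i (tvar j)
    _⇒_   : ∀ {U V} → Neg i U → Pos i V → Pos i (U ⇒ V)

  data Neg {A I : Set} (i : I) : Type A I → Set where
    atom  : ∀ {a} → Neg i (atom a)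
    other : ∀ {j} → j ≢ i → Neg i (tvar j)
    _⇒_   : ∀ {U V} → Pos i U → Neg i V → Neg i (U ⇒ V)

Good : ∀ {A I : Set} → (I → Type A I) → Set
Good F = ∀ i T → F ⊢ tvar i ≈ T → Pos i T

-- Typing judgements, for a distinguished atom ⊥ and equations F.  A context
-- is split into Γ and Δ: Γ lists the types of the λ-variables, and an entry
-- U of Δ at α stands for the declaration α : ¬ U (that is, α : U → ⊥).
module Typing {A I : Set} (⊥ : A) (F : I → Type A I) where

  infix 3 _∣_⊢_∶_

  data _∣_⊢_∶_ {m n : ℕ} (Γ : Vec (Type A I) m) (Δ : Vec (Type A I) n) :
               Term m n → Type A I → Set where
    ax : ∀ x → Γ ∣ Δ ⊢ var x ∶ lookup Γ x
    ≈  : ∀ {M U V} → Γ ∣ Δ ⊢ M ∶ U → F ⊢ U ≈ V → Γ ∣ Δ ⊢ M ∶ V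
    →i : ∀ {M U V} → U ∷ Γ ∣ Δ ⊢ M ∶ V → Γ ∣ Δ ⊢ ƛ M ∶ U ⇒ V
    →e : ∀ {M₁ M₂ U V} → Γ ∣ Δ ⊢ M₁ ∶ U ⇒ V → Γ ∣ Δ ⊢ M₂ ∶ U →
         Γ ∣ Δ ⊢ M₁ · M₂ ∶ V
    ⊥e : ∀ {M U} → Γ ∣ U ∷ Δ ⊢ M ∶ atom ⊥ → Γ ∣ Δ ⊢ μ M ∶ U
    ⊥i : ∀ {M} α → Γ ∣ Δ ⊢ M ∶ lookup Δ α → Γ ∣ Δ ⊢ [ α ] M ∶ atom ⊥

{-# OPTIONS --safe #-}

-- Call a type R applicative if M P₁ … Pₖ is strongly normalizing whenever M : R
-- and P₁ , … , Pₖ are.  Types reachable from R (as subtrees of its infinite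
-- unfolding) but from which R cannot be reached back are strictly below R; as
-- only finitely many types matter for a given derivation, one can show that R
-- is applicative by well-founded induction.  Goodness says that no type is
-- reachable from itself by a path crossing an odd number of domains; hence a
-- type that is reachable from R both positively and negatively is below R.
-- Two substitution lemmas, each by induction on an inductive characterization
-- of strong normalization, then give the result:
--   * call N reducible if N P₁ … Pₖ is strongly normalizing for all strongly
--     normalizing P₁ , … , Pₖ ; substituting reducible terms preserves strong
--     normalization, whatever the types;
--   * if N has a type occurring positively in R, and strongly normalizing terms
--     of types occurring negatively are substituted in it, the result is
--     reducible: when a substituted term P reaches the head, as in y Q₁ … Qₖ
--     with y ↦ P, the arguments Qᵢ are reducible by induction, and the first
--     lemma applies to P.  Further arguments can be present only when the type
--     of y Q₁ … Qₖ is both positive and negative, hence below R, and then they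
--     are reducible as well.
-- A μ-variable of type ¬ U behaves as a λ-variable of the opposite polarity.
module Submission where

open import Defs
open import Data.Bool using (true; false; if_then_else_)
open import Data.Bool.Properties using (if-float)
open import Data.Empty using (⊥-elim)
open import Data.Fin using (Fin; zero; suc; lift; _≟_)
open import Data.Fin.Induction using (spo-wellFounded)
open import Data.List using (List; []; _∷_; _++_; map; concatMap; length) renaming (lookup to lookupᴸ)
open import Data.List.Membership.Propositional using (_∈_)
open import Data.List.Membership.Propositional.Properties using (∈-lookup; ∈-++⁺ˡ; ∈-++⁺ʳ; ∈-++⁻; ∈-concatMap⁺; ∈-concatMap⁻)
open import Data.List.Properties using (map-++; map-cong; map-∘; map-id; ++-identityʳ)
open import Data.List.Relation.Binary.Pointwise as Pointwise using (Pointwise; []; _∷_)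
open import Data.List.Relation.Binary.Subset.Propositional using (_⊆_)
open import Data.List.Relation.Unary.All using (All; []; _∷_)
open import Data.List.Relation.Unary.Any as Any using (here; there; index)
open import Data.List.Relation.Unary.Any.Properties using (lookup-index)
open import Data.Nat using (ℕ; zero; suc)
open import Data.Parity using (Parity; 0ℙ; 1ℙ; _⁻¹; _+_)
open import Data.Parity.Properties using (⁻¹-involutive)
open import Data.Product using (∃-syntax; _×_; _,_; proj₁; proj₂)
open import Data.Sum using (_⊎_; inj₁; inj₂)
open import Data.Vec using (Vec; _∷_; lookup)
open import Function using (id; _∘_; flip)
open import Induction.WellFounded using (Acc; acc; WellFounded)
open import Relation.Binary.Construct.Closure.ReflexiveTransitive using (Star; ε; _◅_; _◅◅_; gmap)
open import Relation.Binary.PropositionalEquality using (_≡_; _≗_; refl; sym; trans; cong; cong₂; subst; subst₂; isEquivalence; resp₂; module ≡-Reasoning)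
open import Relation.Nullary using (¬_; does)

private
  variable
    m n m′ n′ m″ n″ : ℕ

-- Stacks and simultaneous substitution

Stack : ℕ → ℕ → Set
Stack m n = List (Term m n)

infixl 6 _·*_

_·*_ : Term m n → Stack m n → Term m n
M ·* []      = M
M ·* (N ∷ π) = M · N ·* π

·*-++ : ∀ (M : Term m n) π π′ → M ·* (π ++ π′) ≡ M ·* π ·* π′
·*-++ M []      π′ = refl
·*-++ M (N ∷ π) π′ = ·*-++ (M · N) π π′

-- Simultaneous substitution of terms for λ-variables and of named
-- continuations for μ-variables: if α ↦ (β , P₁ ∷ … ∷ Pₖ ∷ []), a subterm
-- (α M) becomes (β (M P₁ … Pₖ)).
record Sub (m n m′ n′ : ℕ) : Set where
  constructor ⟨_∣_⟩
  field
    term : Fin m → Term m′ n′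
    cont : Fin n → Fin n′ × Stack m′ n′

open Sub public

ren : (Fin m → Fin m′) → (Fin n → Fin n′) → Sub m n m′ n′
ren ρ τ = ⟨ var ∘ ρ ∣ (λ α → τ α , []) ⟩

ids : Sub m n m n
ids = ren id id

liftλ : Sub m n m′ n′ → Sub (suc m) n (suc m′) n′
term (liftλ σ)   = extend (term σ)
cont (liftλ σ) α = proj₁ (cont σ α) , map weakenλ (proj₂ (cont σ α))

-- The bound μ-variable is applied to the stack π; liftμ [] is the plain lifting.
liftμ : Stack m′ n′ → Sub m n m′ n′ → Sub m (suc n) m′ (suc n′)
term (liftμ π σ) x       = weakenμ (term σ x)
cont (liftμ π σ) zero    = zero , map weakenμ π
cont (liftμ π σ) (suc α) = suc (proj₁ (cont σ α)) , map weakenμ (proj₂ (cont σ α))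

infixr 5 _◂_

_◂_ : Term m′ n′ → Sub m n m′ n′ → Sub (suc m) n m′ n′
term (N ◂ σ) zero    = N
term (N ◂ σ) (suc x) = term σ x
cont (N ◂ σ)         = cont σ

sub : Sub m n m′ n′ → Term m n → Term m′ n′
sub σ (var x)   = term σ x
sub σ (ƛ M)     = ƛ sub (liftλ σ) M
sub σ (M · N)   = sub σ M · sub σ N
sub σ (μ M)     = μ sub (liftμ [] σ) M
sub σ ([ α ] M) = [ proj₁ (cont σ α) ] (sub σ M ·* proj₂ (cont σ α))

infix 4 _≐_

_≐_ : Sub m n m′ n′ → Sub m n m′ n′ → Set
σ ≐ τ = term σ ≗ term τ × cont σ ≗ cont τ

private
  variable
    σ τ : Sub m n m′ n′

≐-sym : σ ≐ τ → τ ≐ σ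
≐-sym (p , q) = (λ x → sym (p x)) , (λ α → sym (q α))

liftλ-cong : σ ≐ τ → liftλ σ ≐ liftλ τ
liftλ-cong (p , q) =
  (λ { zero → refl ; (suc x) → cong weakenλ (p x) }) ,
  (λ α → cong (λ (β , π) → β , map weakenλ π) (q α))

liftμ-cong : ∀ π → σ ≐ τ → liftμ π σ ≐ liftμ π τ
liftμ-cong π (p , q) =
  (λ x → cong weakenμ (p x)) ,
  (λ { zero → refl ; (suc α) → cong (λ (β , π) → suc β , map weakenμ π) (q α) })

sub-cong : σ ≐ τ → sub σ ≗ sub τ
sub-cong e (var x)   = proj₁ e x
sub-cong e (ƛ M)     = cong ƛ_ (sub-cong (liftλ-cong e) M)
sub-cong e (M · N)   = cong₂ _·_ (sub-cong e M) (sub-cong e N)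
sub-cong e (μ M)     = cong μ_ (sub-cong (liftμ-cong [] e) M)
sub-cong e ([ α ] M) =
  cong₂ (λ (β , π) M → [ β ] (M ·* π)) (proj₂ e α) (sub-cong e M)

sub-·* : ∀ (σ : Sub m n m′ n′) M π → sub σ (M ·* π) ≡ sub σ M ·* map (sub σ) π
sub-·* σ M []      = refl
sub-·* σ M (N ∷ π) = sub-·* σ (M · N) π

liftλ-ren : ∀ (ρ : Fin m → Fin m′) (τ : Fin n → Fin n′) →
            liftλ (ren ρ τ) ≐ ren (lift 1 ρ) τ
liftλ-ren ρ τ = (λ { zero → refl ; (suc x) → refl }) , (λ α → refl)

liftμ-ren : ∀ (ρ : Fin m → Fin m′) (τ : Fin n → Fin n′) →
            liftμ [] (ren ρ τ) ≐ ren ρ (lift 1 τ)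
liftμ-ren ρ τ = (λ x → refl) , (λ { zero → refl ; (suc α) → refl })

rename≡sub : ∀ (ρ : Fin m → Fin m′) (τ : Fin n → Fin n′) →
             rename ρ τ ≗ sub (ren ρ τ)
rename≡sub ρ τ (var x)   = refl
rename≡sub ρ τ (ƛ M)     = cong ƛ_ (trans (rename≡sub (lift 1 ρ) τ M)
                                          (sub-cong (≐-sym (liftλ-ren ρ τ)) M))
rename≡sub ρ τ (M · N)   = cong₂ _·_ (rename≡sub ρ τ M) (rename≡sub ρ τ N)
rename≡sub ρ τ (μ M)     = cong μ_ (trans (rename≡sub ρ (lift 1 τ) M)
                                          (sub-cong (≐-sym (liftμ-ren ρ τ)) M))
rename≡sub ρ τ ([ α ] M) = cong [ τ α ]_ (rename≡sub ρ τ M)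

liftλ-ids : liftλ {m} {n} ids ≐ ids
liftλ-ids = (λ { zero → refl ; (suc x) → refl }) , (λ α → refl)

liftμ-ids : liftμ {m} {n} [] ids ≐ ids
liftμ-ids = (λ x → refl) , (λ { zero → refl ; (suc α) → refl })

sub-ids : (M : Term m n) → sub ids M ≡ M
sub-ids (var x)   = refl
sub-ids (ƛ M)     = cong ƛ_ (trans (sub-cong liftλ-ids M) (sub-ids M))
sub-ids (M · N)   = cong₂ _·_ (sub-ids M) (sub-ids N)
sub-ids (μ M)     = cong μ_ (trans (sub-cong liftμ-ids M) (sub-ids M))
sub-ids ([ α ] M) = cong [ α ]_ (sub-ids M)

rename-id : (M : Term m n) → rename id id M ≡ M
rename-id M = trans (rename≡sub id id M) (sub-ids M)

-- Fusion with renamings comes first: the general law `sub-sub` passes under binders only once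
-- substitution commutes with weakening.
sub-rename : ∀ (σ : Sub m′ n′ m″ n″) (ρ : Fin m → Fin m′) (τ : Fin n → Fin n′) M →
             sub σ (rename ρ τ M) ≡ sub ⟨ term σ ∘ ρ ∣ cont σ ∘ τ ⟩ M
sub-rename σ ρ τ (var x)   = refl
sub-rename σ ρ τ (ƛ M)     = cong ƛ_ (trans (sub-rename (liftλ σ) (lift 1 ρ) τ M)
  (sub-cong ((λ { zero → refl ; (suc x) → refl }) , (λ α → refl)) M))
sub-rename σ ρ τ (M · N)   = cong₂ _·_ (sub-rename σ ρ τ M) (sub-rename σ ρ τ N)
sub-rename σ ρ τ (μ M)     = cong μ_ (trans (sub-rename (liftμ [] σ) ρ (lift 1 τ) M)
  (sub-cong ((λ x → refl) , (λ { zero → refl ; (suc α) → refl })) M))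
sub-rename σ ρ τ ([ α ] M) =
  cong (λ M → [ proj₁ (cont σ (τ α)) ] (M ·* proj₂ (cont σ (τ α)))) (sub-rename σ ρ τ M)

rename-rename : ∀ (ρ′ : Fin m′ → Fin m″) (τ′ : Fin n′ → Fin n″)
                (ρ : Fin m → Fin m′) (τ : Fin n → Fin n′) M →
                rename ρ′ τ′ (rename ρ τ M) ≡ rename (ρ′ ∘ ρ) (τ′ ∘ τ) M
rename-rename ρ′ τ′ ρ τ M = begin
  rename ρ′ τ′ (rename ρ τ M)    ≡⟨ rename≡sub ρ′ τ′ (rename ρ τ M) ⟩
  sub (ren ρ′ τ′) (rename ρ τ M) ≡⟨ sub-rename (ren ρ′ τ′) ρ τ M ⟩
  sub (ren (ρ′ ∘ ρ) (τ′ ∘ τ)) M  ≡⟨ rename≡sub (ρ′ ∘ ρ) (τ′ ∘ τ) M ⟨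
  rename (ρ′ ∘ ρ) (τ′ ∘ τ) M     ∎
  where open ≡-Reasoning

map-commute : ∀ {A B C D : Set} {f : B → D} {g : A → B} {h : C → D} {k : A → C} →
              f ∘ g ≗ h ∘ k → map f ∘ map g ≗ map h ∘ map k
map-commute e xs = trans (sym (map-∘ xs)) (trans (map-cong e xs) (map-∘ xs))

renameSub : (Fin m′ → Fin m″) → (Fin n′ → Fin n″) → Sub m n m′ n′ → Sub m n m″ n″
term (renameSub ρ τ σ) x = rename ρ τ (term σ x)
cont (renameSub ρ τ σ) α = τ (proj₁ (cont σ α)) , map (rename ρ τ) (proj₂ (cont σ α))

rename-weakenλ : ∀ (ρ : Fin m → Fin m′) (τ : Fin n → Fin n′) M →
                 rename (lift 1 ρ) τ (weakenλ M) ≡ weakenλ (rename ρ τ M)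
rename-weakenλ ρ τ M = trans (rename-rename _ _ suc id M) (sym (rename-rename suc id ρ τ M))

rename-weakenμ : ∀ (ρ : Fin m → Fin m′) (τ : Fin n → Fin n′) M →
                 rename ρ (lift 1 τ) (weakenμ M) ≡ weakenμ (rename ρ τ M)
rename-weakenμ ρ τ M = trans (rename-rename _ _ id suc M) (sym (rename-rename id suc ρ τ M))

rename-·* : ∀ (ρ : Fin m → Fin m′) (τ : Fin n → Fin n′) M π →
           rename ρ τ (M ·* π) ≡ rename ρ τ M ·* map (rename ρ τ) π
rename-·* ρ τ M []      = refl
rename-·* ρ τ M (N ∷ π) = rename-·* ρ τ (M · N) π

rename-sub : ∀ (ρ : Fin m′ → Fin m″) (τ : Fin n′ → Fin n″) (σ : Sub m n m′ n′) M →
             rename ρ τ (sub σ M) ≡ sub (renameSub ρ τ σ) M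
rename-sub ρ τ σ (var x)   = refl
rename-sub ρ τ σ (ƛ M)     = cong ƛ_ (trans (rename-sub (lift 1 ρ) τ (liftλ σ) M)
  (sub-cong ((λ { zero → refl ; (suc x) → rename-weakenλ ρ τ (term σ x) }) ,
             (λ α → cong (_ ,_) (map-commute (rename-weakenλ ρ τ) (proj₂ (cont σ α))))) M))
rename-sub ρ τ σ (M · N)   = cong₂ _·_ (rename-sub ρ τ σ M) (rename-sub ρ τ σ N)
rename-sub ρ τ σ (μ M)     = cong μ_ (trans (rename-sub ρ (lift 1 τ) (liftμ [] σ) M)
  (sub-cong ((λ x → rename-weakenμ ρ τ (term σ x)) ,
             (λ { zero → refl
                ; (suc α) → cong (_ ,_) (map-commute (rename-weakenμ ρ τ) (proj₂ (cont σ α))) })) M))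
rename-sub ρ τ σ ([ α ] M) = cong [ _ ]_
  (trans (rename-·* ρ τ (sub σ M) π) (cong (_·* map (rename ρ τ) π) (rename-sub ρ τ σ M)))
  where π = proj₂ (cont σ α)

sub-weakenλ : ∀ (σ : Sub m n m′ n′) M → sub (liftλ σ) (weakenλ M) ≡ weakenλ (sub σ M)
sub-weakenλ σ M = trans (sub-rename (liftλ σ) suc id M) (sym (rename-sub suc id σ M))

-- A weakened term never names the μ-variable of index zero, so nothing in it receives the stack
-- `π`.
sub-weakenμ : ∀ π (σ : Sub m n m′ n′) M → sub (liftμ π σ) (weakenμ M) ≡ weakenμ (sub σ M)
sub-weakenμ π σ M = trans (sub-rename (liftμ π σ) id suc M) (sym (rename-sub id suc σ M))

-- Composition of substitutions

infixr 9 _⊙_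

-- A named term meets the arguments from `τ` first, so these, after substitution by `σ`, precede the
-- ones that `σ` adds.
_⊙_ : Sub m′ n′ m″ n″ → Sub m n m′ n′ → Sub m n m″ n″
term (σ ⊙ τ) x = sub σ (term τ x)
cont (σ ⊙ τ) α = proj₁ (cont σ (proj₁ (cont τ α))) ,
                 map (sub σ) (proj₂ (cont τ α)) ++ proj₂ (cont σ (proj₁ (cont τ α)))

liftλ-⊙ : ∀ (σ : Sub m′ n′ m″ n″) (τ : Sub m n m′ n′) →
          liftλ σ ⊙ liftλ τ ≐ liftλ (σ ⊙ τ)
liftλ-⊙ σ τ =
  (λ { zero → refl ; (suc x) → sub-weakenλ σ (term τ x) }) ,
  (λ α → cong (_ ,_)
    (trans (cong (_++ _) (map-commute (sub-weakenλ σ) (proj₂ (cont τ α))))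
           (sym (map-++ weakenλ (map (sub σ) (proj₂ (cont τ α))) _))))

liftμ-⊙ : ∀ π π′ (σ : Sub m′ n′ m″ n″) (τ : Sub m n m′ n′) →
          liftμ π σ ⊙ liftμ π′ τ ≐ liftμ (map (sub σ) π′ ++ π) (σ ⊙ τ)
liftμ-⊙ π π′ σ τ =
  (λ x → sub-weakenμ π σ (term τ x)) ,
  (λ { zero    → cong (_ ,_) (eq π′ _)
     ; (suc α) → cong (_ ,_) (eq (proj₂ (cont τ α)) _) })
  where
  eq : ∀ π₁ π₂ → map (sub (liftμ π σ)) (map weakenμ π₁) ++ map weakenμ π₂ ≡
                 map weakenμ (map (sub σ) π₁ ++ π₂)
  eq π₁ π₂ = trans (cong (_++ _) (map-commute (sub-weakenμ π σ) π₁))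
                   (sym (map-++ weakenμ (map (sub σ) π₁) π₂))

sub-sub : ∀ (σ : Sub m′ n′ m″ n″) (τ : Sub m n m′ n′) M → sub σ (sub τ M) ≡ sub (σ ⊙ τ) M
sub-sub σ τ (var x)   = refl
sub-sub σ τ (ƛ M)     = cong ƛ_ (trans (sub-sub (liftλ σ) (liftλ τ) M) (sub-cong (liftλ-⊙ σ τ) M))
sub-sub σ τ (M · N)   = cong₂ _·_ (sub-sub σ τ M) (sub-sub σ τ N)
sub-sub σ τ (μ M)     = cong μ_ (trans (sub-sub (liftμ [] σ) (liftμ [] τ) M)
                                       (sub-cong (liftμ-⊙ [] [] σ τ) M))
sub-sub σ τ ([ α ] M) = cong [ _ ]_ (begin
  sub σ (sub τ M ·* π) ·* π′              ≡⟨ cong (_·* π′) (sub-·* σ (sub τ M) π) ⟩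
  sub σ (sub τ M) ·* map (sub σ) π ·* π′  ≡⟨ ·*-++ (sub σ (sub τ M)) (map (sub σ) π) π′ ⟨
  sub σ (sub τ M) ·* (map (sub σ) π ++ π′) ≡⟨ cong (_·* (map (sub σ) π ++ π′)) (sub-sub σ τ M) ⟩
  sub (σ ⊙ τ) M ·* (map (sub σ) π ++ π′) ∎)
  where
  open ≡-Reasoning
  π  = proj₂ (cont τ α)
  π′ = proj₂ (cont σ (proj₁ (cont τ α)))

⊙-identityˡ : ∀ (σ : Sub m n m′ n′) → ids ⊙ σ ≐ σ
⊙-identityˡ σ =
  (λ x → sub-ids (term σ x)) ,
  (λ α → cong (_ ,_) (trans (++-identityʳ _) (trans (map-cong sub-ids _) (map-id _))))

-- The substitutions of the calculus as simultaneous substitutions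

substitute≡sub : ∀ (ς : Fin m → Term m′ n) → substitute ς ≗ sub ⟨ ς ∣ cont ids ⟩
substitute≡sub ς (var x)   = refl
substitute≡sub ς (ƛ M)     = cong ƛ_ (substitute≡sub (extend ς) M)
substitute≡sub ς (M · N)   = cong₂ _·_ (substitute≡sub ς M) (substitute≡sub ς N)
substitute≡sub ς (μ M)     = cong μ_ (trans (substitute≡sub (weakenμ ∘ ς) M)
  (sub-cong ((λ x → refl) , (λ { zero → refl ; (suc α) → refl })) M))
substitute≡sub ς ([ α ] M) = cong [ α ]_ (substitute≡sub ς M)

[0:=]≡sub : ∀ (M : Term (suc m) n) N → M [0:= N ] ≡ sub (N ◂ ids) M
[0:=]≡sub M N = trans (substitute≡sub (single N) M)
  (sub-cong ((λ { zero → refl ; (suc x) → refl }) , (λ α → refl)) M)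

push : Fin n → Term m n → Sub m n m n
term (push α N) = var
cont (push α N) β = β , (if does (β ≟ α) then N ∷ [] else [])

[=′]≡sub : ∀ (M : Term m n) α N → M [ α =′ N ] ≡ sub (push α N) M
[=′]≡sub (var x)   α N = refl
[=′]≡sub (ƛ M)     α N = cong ƛ_ (trans ([=′]≡sub M α (weakenλ N)) (sub-cong
  ((λ { zero → refl ; (suc x) → refl }) , (λ β → cong (β ,_) (sym (if-float (map weakenλ) (does (β ≟ α)))))) M))
[=′]≡sub (M₁ · M₂) α N = cong₂ _·_ ([=′]≡sub M₁ α N) ([=′]≡sub M₂ α N)
[=′]≡sub (μ M)     α N = cong μ_ (trans ([=′]≡sub M (suc α) (weakenμ N)) (sub-cong
  ((λ x → refl) , (λ { zero → refl ; (suc β) → cong (suc β ,_) (sym (if-float (map weakenμ) (does (β ≟ α)))) })) M))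
[=′]≡sub ([ β ] M) α N with does (β ≟ α)
... | true  = cong (λ M → [ β ] (M · N)) ([=′]≡sub M α N)
... | false = cong [ β ]_ ([=′]≡sub M α N)

[0=′]≡sub : ∀ (M : Term m (suc n)) N → M [ zero =′ weakenμ N ] ≡ sub (liftμ (N ∷ []) ids) M
[0=′]≡sub M N = trans ([=′]≡sub M zero (weakenμ N))
  (sub-cong ((λ x → refl) , (λ { zero → refl ; (suc α) → refl })) M)

-- The weakening introduced by `liftλ` is undone by `N ◂ ids`, so contraction after substitution
-- merely extends the environment.
sub-◂ : ∀ (σ : Sub m n m′ n′) N M → (sub (liftλ σ) M) [0:= N ] ≡ sub (N ◂ σ) M
sub-◂ σ N M = begin
  sub (liftλ σ) M [0:= N ]          ≡⟨ [0:=]≡sub (sub (liftλ σ) M) N ⟩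
  sub (N ◂ ids) (sub (liftλ σ) M)   ≡⟨ sub-sub (N ◂ ids) (liftλ σ) M ⟩
  sub ((N ◂ ids) ⊙ liftλ σ) M       ≡⟨ sub-cong ((λ { zero → refl ; (suc x) → cancel (term σ x) }) , cancel-cont) M ⟩
  sub (N ◂ σ) M                     ∎
  where
  open ≡-Reasoning
  cancel : ∀ P → sub (N ◂ ids) (weakenλ P) ≡ P
  cancel P = trans (sub-rename (N ◂ ids) suc id P) (sub-ids P)
  cancel-cont : cont ((N ◂ ids) ⊙ liftλ σ) ≗ cont σ
  cancel-cont α = cong (_ ,_) (trans (++-identityʳ _)
    (trans (sym (map-∘ (proj₂ (cont σ α)))) (trans (map-cong cancel (proj₂ (cont σ α))) (map-id _))))

sub-[0:=] : ∀ (σ : Sub m n m′ n′) M N →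
            sub σ (M [0:= N ]) ≡ (sub (liftλ σ) M) [0:= sub σ N ]
sub-[0:=] σ M N = begin
  sub σ (M [0:= N ])                 ≡⟨ cong (sub σ) ([0:=]≡sub M N) ⟩
  sub σ (sub (N ◂ ids) M)            ≡⟨ sub-sub σ (N ◂ ids) M ⟩
  sub (σ ⊙ (N ◂ ids)) M              ≡⟨ sub-cong ((λ { zero → refl ; (suc x) → refl }) , (λ α → refl)) M ⟩
  sub (sub σ N ◂ σ) M                ≡⟨ sub-◂ σ (sub σ N) M ⟨
  sub (liftλ σ) M [0:= sub σ N ]     ∎
  where open ≡-Reasoning

-- Successive μ-contractions accumulate their arguments in order, so that a μ-abstraction can absorb
-- a whole stack.
sub-liftμ-liftμ : ∀ π π′ (σ : Sub m n m′ n′) M →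
                  sub (liftμ π′ ids) (sub (liftμ π σ) M) ≡ sub (liftμ (π ++ π′) σ) M
sub-liftμ-liftμ π π′ σ M = begin
  sub (liftμ π′ ids) (sub (liftμ π σ) M)            ≡⟨ sub-sub (liftμ π′ ids) (liftμ π σ) M ⟩
  sub (liftμ π′ ids ⊙ liftμ π σ) M                  ≡⟨ sub-cong (liftμ-⊙ π′ π ids σ) M ⟩
  sub (liftμ (map (sub ids) π ++ π′) (ids ⊙ σ)) M   ≡⟨ cong (λ π → sub (liftμ (π ++ π′) (ids ⊙ σ)) M) (trans (map-cong sub-ids π) (map-id π)) ⟩
  sub (liftμ (π ++ π′) (ids ⊙ σ)) M                 ≡⟨ sub-cong (liftμ-cong (π ++ π′) (⊙-identityˡ σ)) M ⟩
  sub (liftμ (π ++ π′) σ) M                         ∎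
  where open ≡-Reasoning

sub-[0=′] : ∀ (σ : Sub m n m′ n′) M N →
            sub (liftμ [] σ) (M [ zero =′ weakenμ N ]) ≡
            sub (liftμ [] σ) M [ zero =′ weakenμ (sub σ N) ]
sub-[0=′] σ M N = begin
  sub (liftμ [] σ) (M [ zero =′ weakenμ N ])           ≡⟨ cong (sub (liftμ [] σ)) ([0=′]≡sub M N) ⟩
  sub (liftμ [] σ) (sub (liftμ (N ∷ []) ids) M)        ≡⟨ sub-sub (liftμ [] σ) (liftμ (N ∷ []) ids) M ⟩
  sub (liftμ [] σ ⊙ liftμ (N ∷ []) ids) M              ≡⟨ sub-cong (liftμ-⊙ [] (N ∷ []) σ ids) M ⟩
  sub (liftμ (sub σ N ∷ []) (σ ⊙ ids)) M               ≡⟨ sub-cong (liftμ-cong (sub σ N ∷ []) ((λ x → refl) , (λ α → refl))) M ⟩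
  sub (liftμ (sub σ N ∷ []) σ) M                       ≡⟨ sub-liftμ-liftμ [] (sub σ N ∷ []) σ M ⟨
  sub (liftμ (sub σ N ∷ []) ids) (sub (liftμ [] σ) M)  ≡⟨ [0=′]≡sub (sub (liftμ [] σ) M) (sub σ N) ⟨
  sub (liftμ [] σ) M [ zero =′ weakenμ (sub σ N) ]     ∎
  where open ≡-Reasoning

-- Reduction and termination

private
  variable
    C H M M′ N N′ Z : Term m n
    π π′ : Stack m n

infix 4 _·_↦_ _▷*_ _▷ₛ_ _▷*ˢ_

-- Contractions at the root, with function and argument as separate indices: head expansion can
-- treat both kinds of redex at once and still name the argument.
data _·_↦_ {m n} : Term m n → Term m n → Term m n → Set where
  βλ : ∀ {M N} → (ƛ M) · N ↦ M [0:= N ]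
  βμ : ∀ {M N} → (μ M) · N ↦ μ (M [ zero =′ weakenμ N ])

↦⇒▷ : H · N ↦ C → H · N ▷ C
↦⇒▷ βλ = βλ
↦⇒▷ βμ = βμ

sub-↦ : ∀ (σ : Sub m n m′ n′) → H · N ↦ C → sub σ H · sub σ N ↦ sub σ C
sub-↦ σ (βλ {M} {N}) = subst (sub σ (ƛ M) · sub σ N ↦_) (sym (sub-[0:=] σ M N)) βλ
sub-↦ σ (βμ {M} {N}) = subst (sub σ (μ M) · sub σ N ↦_) (cong μ_ (sym (sub-[0=′] σ M N))) βμ

·*-monoˡ : ∀ π → M ▷ M′ → M ·* π ▷ M′ ·* π
·*-monoˡ []      r = r
·*-monoˡ (N ∷ π) r = ·*-monoˡ π (ξ-·ˡ r)

sub-▷ : ∀ (σ : Sub m n m′ n′) → M ▷ M′ → sub σ M ▷ sub σ M′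
sub-▷ σ (βλ {M} {N})     = ↦⇒▷ (sub-↦ σ (βλ {M = M} {N}))
sub-▷ σ (βμ {M} {N})     = ↦⇒▷ (sub-↦ σ (βμ {M = M} {N}))
sub-▷ σ (ξ-ƛ r)          = ξ-ƛ (sub-▷ (liftλ σ) r)
sub-▷ σ (ξ-·ˡ r)         = ξ-·ˡ (sub-▷ σ r)
sub-▷ σ (ξ-·ʳ r)         = ξ-·ʳ (sub-▷ σ r)
sub-▷ σ (ξ-μ r)          = ξ-μ (sub-▷ (liftμ [] σ) r)
sub-▷ σ (ξ-[] {α = α} r) = ξ-[] (·*-monoˡ (proj₂ (cont σ α)) (sub-▷ σ r))

rename-▷ : ∀ (ρ : Fin m → Fin m′) (τ : Fin n → Fin n′) →
           M ▷ M′ → rename ρ τ M ▷ rename ρ τ M′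
rename-▷ {M = M} {M′ = M′} ρ τ r =
  subst₂ _▷_ (sym (rename≡sub ρ τ M)) (sym (rename≡sub ρ τ M′)) (sub-▷ (ren ρ τ) r)

_▷*_ : Term m n → Term m n → Set
_▷*_ = Star _▷_

·-mono* : M ▷* M′ → N ▷* N′ → M · N ▷* M′ · N′
·-mono* rs rs′ = gmap (_· _) ξ-·ˡ rs ◅◅ gmap (_ ·_) ξ-·ʳ rs′

·*-mono* : M ▷* M′ → Pointwise _▷*_ π π′ → M ·* π ▷* M′ ·* π′
·*-mono* rs []         = rs
·*-mono* rs (rs′ ∷ ps) = ·*-mono* (·-mono* rs rs′) ps

_▷*ˢ_ : Sub m n m′ n′ → Sub m n m′ n′ → Set
σ ▷*ˢ τ = (∀ x → term σ x ▷* term τ x) ×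
          (∀ α → proj₁ (cont σ α) ≡ proj₁ (cont τ α) ×
                 Pointwise _▷*_ (proj₂ (cont σ α)) (proj₂ (cont τ α)))

weaken-mono* : ∀ {f : Term m n → Term m′ n′} → (∀ {M M′} → M ▷ M′ → f M ▷ f M′) →
               Pointwise _▷*_ π π′ → Pointwise _▷*_ (map f π) (map f π′)
weaken-mono* {f = f} mono ps = Pointwise.map⁺ f f (Pointwise.map (gmap f mono) ps)

liftλ-mono* : σ ▷*ˢ τ → liftλ σ ▷*ˢ liftλ τ
liftλ-mono* (p , q) =
  (λ { zero → ε ; (suc x) → gmap weakenλ (rename-▷ suc id) (p x) }) ,
  (λ α → proj₁ (q α) , weaken-mono* (rename-▷ suc id) (proj₂ (q α)))

liftμ-mono* : Pointwise _▷*_ π π′ → σ ▷*ˢ τ → liftμ π σ ▷*ˢ liftμ π′ τ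
liftμ-mono* ps (p , q) =
  (λ x → gmap weakenμ (rename-▷ id suc) (p x)) ,
  (λ { zero    → refl , weaken-mono* (rename-▷ id suc) ps
     ; (suc α) → cong suc (proj₁ (q α)) , weaken-mono* (rename-▷ id suc) (proj₂ (q α)) })

sub-mono* : σ ▷*ˢ τ → ∀ M → sub σ M ▷* sub τ M
sub-mono* e (var x) = proj₁ e x
sub-mono* e (ƛ M)   = gmap ƛ_ ξ-ƛ (sub-mono* (liftλ-mono* e) M)
sub-mono* e (M · N) = ·-mono* (sub-mono* e M) (sub-mono* e N)
sub-mono* e (μ M)   = gmap μ_ ξ-μ (sub-mono* (liftμ-mono* [] e) M)
sub-mono* {σ = σ} {τ = τ} e ([ α ] M) with cont σ α | cont τ α | proj₂ e α
... | β , π | .β , π′ | refl , ps = gmap [ β ]_ ξ-[] (·*-mono* (sub-mono* e M) ps)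

ids-mono* : ids {m} {n} ▷*ˢ ids
ids-mono* = (λ x → ε) , (λ α → refl , [])

↦-reduceˡ : H · N ↦ C → H ▷ M → ∃[ C′ ] M · N ↦ C′ × C ▷ C′
↦-reduceˡ (βλ {N = N}) (ξ-ƛ {M} {M′} r) = _ , βλ ,
  subst₂ _▷_ (sym ([0:=]≡sub M N)) (sym ([0:=]≡sub M′ N)) (sub-▷ (N ◂ ids) r)
↦-reduceˡ (βμ {N = N}) (ξ-μ {M} {M′} r) = _ , βμ ,
  ξ-μ (subst₂ _▷_ (sym ([0=′]≡sub M N)) (sym ([0=′]≡sub M′ N)) (sub-▷ (liftμ (N ∷ []) ids) r))

-- The contractum can hold any number of copies of the argument, hence a possibly empty sequence of
-- steps.
↦-reduceʳ : H · N ↦ C → N ▷ M → ∃[ C′ ] H · M ↦ C′ × C ▷* C′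
↦-reduceʳ {N = N} {M = N′} (βλ {M = M}) r = _ , βλ ,
  subst₂ _▷*_ (sym ([0:=]≡sub M N)) (sym ([0:=]≡sub M N′))
    (sub-mono* ((λ { zero → r ◅ ε ; (suc x) → ε }) , proj₂ ids-mono*) M)
↦-reduceʳ {N = N} {M = N′} (βμ {M = M}) r = _ , βμ ,
  gmap μ_ ξ-μ (subst₂ _▷*_ (sym ([0=′]≡sub M N)) (sym ([0=′]≡sub M N′))
    (sub-mono* (liftμ-mono* ((r ◅ ε) ∷ []) ids-mono*) M))

data _▷ₛ_ {m n} : Stack m n → Stack m n → Set where
  here  : N ▷ N′ → N ∷ π ▷ₛ N′ ∷ π
  there : π ▷ₛ π′ → N ∷ π ▷ₛ N ∷ π′

·*-monoʳ : ∀ (M : Term m n) → π ▷ₛ π′ → M ·* π ▷ M ·* π′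
·*-monoʳ M (here {π = π} r)  = ·*-monoˡ π (ξ-·ʳ r)
·*-monoʳ M (there {N = N} r) = ·*-monoʳ (M · N) r

-- Heads that form no redex with the next argument, so that a step of `M ·* π` is a step of `M` or
-- of an element of `π`.
data Inert {m n} : Term m n → Set where
  var : ∀ x → Inert (var x)
  _·_ : ∀ M N → Inert (M · N)

·*-▷⁻ : Inert M → ∀ π → M ·* π ▷ Z →
        (∃[ M′ ] M ▷ M′ × Z ≡ M′ ·* π) ⊎ (∃[ π′ ] π ▷ₛ π′ × Z ≡ M ·* π′)
·*-▷⁻ i []      r = inj₁ (_ , r , refl)
·*-▷⁻ i (N ∷ π) r with ·*-▷⁻ (_ · N) π r
·*-▷⁻ () (N ∷ π) r | inj₁ (_ , βλ , refl)
·*-▷⁻ () (N ∷ π) r | inj₁ (_ , βμ , refl)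
... | inj₁ (_ , ξ-·ˡ r′ , refl) = inj₁ (_ , r′ , refl)
... | inj₁ (_ , ξ-·ʳ r′ , refl) = inj₂ (_ , here r′ , refl)
... | inj₂ (_ , r′ , refl)      = inj₂ (_ , there r′ , refl)

-- Termination and head expansion

Terminating : Term m n → Set
Terminating = Acc (flip _▷_)

terminating-▷* : Terminating M → M ▷* M′ → Terminating M′
terminating-▷* a       ε        = a
terminating-▷* (acc a) (r ◅ rs) = terminating-▷* (a r) rs

terminating-ƛ : {M : Term (suc m) n} → Terminating M → Terminating (ƛ M)
terminating-ƛ (acc a) = acc λ { (ξ-ƛ r) → terminating-ƛ (a r) }

terminating-μ : {M : Term m (suc n)} → Terminating M → Terminating (μ M)
terminating-μ (acc a) = acc λ { (ξ-μ r) → terminating-μ (a r) }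

terminating-[] : ∀ {α} {M : Term m n} → Terminating M → Terminating ([ α ] M)
terminating-[] (acc a) = acc λ { (ξ-[] r) → terminating-[] (a r) }

acc-stack : All Terminating π → Acc (flip _▷ₛ_) π
acc-stack []       = acc λ ()
acc-stack (a ∷ as) = acc-∷ a (acc-stack as)
  where
  acc-∷ : Terminating N → Acc (flip _▷ₛ_) π → Acc (flip _▷ₛ_) (N ∷ π)
  acc-∷ (acc a) (acc b) = acc λ where
    (here r)  → acc-∷ (a r) (acc b)
    (there r) → acc-∷ (acc a) (b r)

terminating-var : ∀ (x : Fin m) {π : Stack m n} → All Terminating π → Terminating (var x ·* π)
terminating-var {m} {n} x as = go _ (acc-stack as)
  where
  go : ∀ (π : Stack m n) → Acc (flip _▷ₛ_) π → Terminating (var x ·* π)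
  step : ∀ (π : Stack m n) → Acc (flip _▷ₛ_) π → var x ·* π ▷ Z → Terminating Z
  go π a = acc (step π a)
  step π (acc a) r with ·*-▷⁻ (var x) π r
  ... | inj₂ (π′ , r′ , refl) = go π′ (a r′)

-- Lexicographic induction on termination of `N`, then of `C ·* π`. A step other than the
-- contraction leaves a redex with a reduced argument, or one whose contractum in its stack has made
-- a step. Termination of `N` is assumed separately since contraction may erase `N`.
terminating-↦ : ∀ (π : Stack m n) → H · N ↦ C →
                Terminating N → Terminating (C ·* π) → Terminating (H · N ·* π)
terminating-↦ {m} {n} π c a b = acc (step π c a b)
  where
  step : ∀ {H N C Z} (π : Stack m n) → H · N ↦ C →
         Terminating N → Terminating (C ·* π) → H · N ·* π ▷ Z → Terminating Z
  step π c a b r with ·*-▷⁻ (_ · _) π r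
  step π βλ a b r | inj₁ (_ , βλ , refl) = b
  step π βμ a b r | inj₁ (_ , βμ , refl) = b
  step π c a (acc b) r | inj₁ (_ , ξ-·ˡ r′ , refl) with ↦-reduceˡ c r′
  ... | _ , c′ , s = acc (step π c′ a (b (·*-monoˡ π s)))
  step π c (acc a) b r | inj₁ (_ , ξ-·ʳ r′ , refl) with ↦-reduceʳ c r′
  ... | _ , c′ , s = acc (step π c′ (a r′) (terminating-▷* b (gmap (_·* π) (·*-monoˡ π) s)))
  step {C = C} π c a (acc b) r | inj₂ (π′ , r′ , refl) = acc (step π′ c a (b (·*-monoʳ C r′)))

-- Types modulo finitely many equations

module Types {A I : Set} (F : I → Type A I) (S : List (Type A I))
  (closed : ∀ {U V} → U ⇒ V ∈ S → U ∈ S × V ∈ S) where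

  private
    variable
      a : A
      p q : Parity
      T U U′ V V′ W : Type A I

  infix 4 _⇛_ _⇛*_ _≃_ _⊒[_]_ _⊒_ _⊐_

  -- Parallel unfolding: any set of variable occurrences is replaced in one step, which gives the
  -- diamond property directly.
  data _⇛_ : Type A I → Type A I → Set where
    atom   : ∀ {a} → atom a ⇛ atom a
    tvar   : ∀ {i} → tvar i ⇛ tvar i
    unfold : ∀ {i} → F i ∈ S → tvar i ⇛ F i
    _⇒_    : U ⇛ U′ → V ⇛ V′ → U ⇒ V ⇛ U′ ⇒ V′

  _⇛*_ : Type A I → Type A I → Set
  _⇛*_ = Star _⇛_

  ⇛-refl : ∀ {T} → T ⇛ T
  ⇛-refl {atom _} = atom
  ⇛-refl {tvar _} = tvar
  ⇛-refl {_ ⇒ _}  = ⇛-refl ⇒ ⇛-refl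

  ⇛-diamond : T ⇛ U → T ⇛ V → ∃[ W ] U ⇛ W × V ⇛ W
  ⇛-diamond atom       atom       = _ , atom , atom
  ⇛-diamond tvar       s          = _ , s , ⇛-refl
  ⇛-diamond (unfold u) tvar       = _ , ⇛-refl , unfold u
  ⇛-diamond (unfold _) (unfold _) = _ , ⇛-refl , ⇛-refl
  ⇛-diamond (r₁ ⇒ r₂)  (s₁ ⇒ s₂)  with ⇛-diamond r₁ s₁ | ⇛-diamond r₂ s₂
  ... | _ , r₁′ , s₁′ | _ , r₂′ , s₂′ = _ , r₁′ ⇒ r₂′ , s₁′ ⇒ s₂′

  ⇛-strip : T ⇛ U → T ⇛* V → ∃[ W ] U ⇛* W × V ⇛ W
  ⇛-strip r ε = _ , ε , r
  ⇛-strip r (s ◅ ss) with ⇛-diamond r s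
  ... | _ , s′ , r′ with ⇛-strip r′ ss
  ... | _ , ss′ , r″ = _ , s′ ◅ ss′ , r″

  ⇛*-confluent : T ⇛* U → T ⇛* V → ∃[ W ] U ⇛* W × V ⇛* W
  ⇛*-confluent ε ss = _ , ss , ε
  ⇛*-confluent (r ◅ rs) ss with ⇛-strip r ss
  ... | _ , ss′ , r′ with ⇛*-confluent rs ss′
  ... | _ , ss″ , rs′ = _ , ss″ , r′ ◅ rs′

  -- The congruence generated by the finitely many equations whose right-hand
  -- side belongs to S.
  data _≃_ (U V : Type A I) : Set where
    join : U ⇛* W → V ⇛* W → U ≃ V

  ≃-refl : T ≃ T
  ≃-refl = join ε ε

  ≃-sym : U ≃ V → V ≃ U
  ≃-sym (join r s) = join s r

  ≃-trans : U ≃ V → V ≃ W → U ≃ W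
  ≃-trans (join r s) (join r′ s′) with ⇛*-confluent s r′
  ... | _ , s₁ , r₁ = join (r ◅◅ s₁) (s′ ◅◅ r₁)

  ⇒-cong* : U ⇛* U′ → V ⇛* V′ → U ⇒ V ⇛* U′ ⇒ V′
  ⇒-cong* rs ss = gmap (_⇒ _) (_⇒ ⇛-refl) rs ◅◅ gmap (_ ⇒_) (⇛-refl ⇒_) ss

  ≃-⇒ : U ≃ U′ → V ≃ V′ → U ⇒ V ≃ U′ ⇒ V′
  ≃-⇒ (join r s) (join r′ s′) = join (⇒-cong* r r′) (⇒-cong* s s′)

  ≃-unfold : ∀ {i} → F i ∈ S → tvar i ≃ F i
  ≃-unfold u = join (unfold u ◅ ε) ε

  ⇒-⇛*⁻ : U ⇒ V ⇛* T → ∃[ U′ ] ∃[ V′ ] T ≡ U′ ⇒ V′ × U ⇛* U′ × V ⇛* V′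
  ⇒-⇛*⁻ ε = _ , _ , refl , ε , ε
  ⇒-⇛*⁻ ((r ⇒ s) ◅ ts) with ⇒-⇛*⁻ ts
  ... | _ , _ , refl , rs , ss = _ , _ , refl , r ◅ rs , s ◅ ss

  -- Unfolding preserves an arrow at the root, so a common reduct of two arrows joins them
  -- componentwise. This is the gain from defining `≃` by joinability.
  ⇒-injective : U ⇒ V ≃ U′ ⇒ V′ → U ≃ U′ × V ≃ V′
  ⇒-injective (join r s) with ⇒-⇛*⁻ r | ⇒-⇛*⁻ s
  ... | _ , _ , refl , r₁ , r₂ | _ , _ , refl , s₁ , s₂ = join r₁ s₁ , join r₂ s₂

  atom≄⇒ : ¬ (atom a ≃ U ⇒ V)
  atom≄⇒ (join (atom ◅ r) s) = atom≄⇒ (join r s)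
  atom≄⇒ (join ε s) with ⇒-⇛*⁻ s
  ... | _ , _ , () , _

  ⇛-sound : U ⇛ V → F ⊢ U ≈ V
  ⇛-sound atom       = ≈-refl
  ⇛-sound tvar       = ≈-refl
  ⇛-sound (unfold _) = ≈-eqn _
  ⇛-sound (r ⇒ s)    = ≈-⇒ (⇛-sound r) (⇛-sound s)

  ⇛*-sound : U ⇛* V → F ⊢ U ≈ V
  ⇛*-sound ε        = ≈-refl
  ⇛*-sound (r ◅ rs) = ≈-trans (⇛-sound r) (⇛*-sound rs)

  ≃-sound : U ≃ V → F ⊢ U ≈ V
  ≃-sound (join r s) = ≈-trans (⇛*-sound r) (≈-sym (⇛*-sound s))

  -- T ⊒[ p ] W: up to ≃, W is a subtree of the infinite unfolding of T, at a
  -- position whose polarity is given by p (0ℙ positive, 1ℙ negative).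
  data _⊒[_]_ (T : Type A I) : Parity → Type A I → Set where
    here : T ≃ W → T ⊒[ 0ℙ ] W
    dom  : T ≃ U ⇒ V → U ⊒[ p ⁻¹ ] W → T ⊒[ p ] W
    cod  : T ≃ U ⇒ V → V ⊒[ p ] W → T ⊒[ p ] W

  ⊒-respˡ : U ≃ T → T ⊒[ p ] W → U ⊒[ p ] W
  ⊒-respˡ e (here e′)  = here (≃-trans e e′)
  ⊒-respˡ e (dom e′ t) = dom (≃-trans e e′) t
  ⊒-respˡ e (cod e′ t) = cod (≃-trans e e′) t

  ⁻¹-+ : ∀ p q → p ⁻¹ + q ≡ (p + q) ⁻¹
  ⁻¹-+ 0ℙ q = refl
  ⁻¹-+ 1ℙ q = sym (⁻¹-involutive q)

  ⊒-trans : T ⊒[ p ] U → U ⊒[ q ] W → T ⊒[ p + q ] W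
  ⊒-trans (here e)          u = ⊒-respˡ e u
  ⊒-trans {p = p} (dom e t) u = dom e (subst (_ ⊒[_] _) (⁻¹-+ p _) (⊒-trans t u))
  ⊒-trans (cod e t)         u = cod e (⊒-trans t u)

  -- Rebuilding `T` along the path gives an equivalent type in which the variable literally occurs
  -- at the end of the path; this occurrence admits only the sign matching its parity.
  ⊒-polarity : ∀ {i} → T ⊒[ p ] tvar i →
               ∃[ U ] F ⊢ T ≈ U × (Pos i U → p ≡ 0ℙ) × (Neg i U → p ≡ 1ℙ)
  ⊒-polarity (here e) = _ , ≃-sound e , (λ _ → refl) , λ { (other i≢i) → ⊥-elim (i≢i refl) }
  ⊒-polarity {p = p} (dom e t) with ⊒-polarity t
  ... | _ , e′ , pos , neg =
    _ , ≈-trans (≃-sound e) (≈-⇒ e′ ≈-refl) ,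
    (λ { (n ⇒ _) → flipped (neg n) }) , (λ { (n ⇒ _) → flipped (pos n) })
    where
    flipped : p ⁻¹ ≡ q → p ≡ q ⁻¹
    flipped e = trans (sym (⁻¹-involutive p)) (cong _⁻¹ e)
  ⊒-polarity (cod e t) with ⊒-polarity t
  ... | _ , e′ , pos , neg =
    _ , ≈-trans (≃-sound e) (≈-⇒ ≈-refl e′) , (λ { (_ ⇒ n) → pos n }) , (λ { (_ ⇒ n) → neg n })

  -- An odd cycle through an arrow can be rotated to one through a strict
  -- subterm of that arrow, hence ultimately to one through a type variable.
  ⊒-no-odd-cycle : Good F → ∀ T → ¬ (T ⊒[ 1ℙ ] T)
  ⊒-no-odd-cycle good (atom a) (dom e _) = atom≄⇒ e
  ⊒-no-odd-cycle good (atom a) (cod e _) = atom≄⇒ e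
  ⊒-no-odd-cycle good (tvar i) t with ⊒-polarity t
  -- Goodness makes `U` positive, but the cycle places the variable in it at an odd position.
  ... | U , e , pos , _ with pos (good i U e)
  ... | ()
  ⊒-no-odd-cycle good (U ⇒ V) (dom e t) = ⊒-no-odd-cycle good U
    (⊒-trans (⊒-respˡ (proj₁ (⇒-injective e)) t) (dom ≃-refl (here ≃-refl)))
  ⊒-no-odd-cycle good (U ⇒ V) (cod e t) = ⊒-no-odd-cycle good V
    (⊒-trans (⊒-respˡ (proj₂ (⇒-injective e)) t) (cod ≃-refl (here ≃-refl)))

  -- The strict order on types and its well-foundedness

  _⊒_ : Type A I → Type A I → Set
  T ⊒ W = ∃[ p ] T ⊒[ p ] W

  _⊐_ : Type A I → Type A I → Set
  R ⊐ T = R ⊒ T × ¬ (T ⊒ R)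

  ⊒-⊐-trans : T ⊒ U → U ⊐ W → T ⊐ W
  ⊒-⊐-trans (p , t) ((q , u) , ¬w) = (_ , ⊒-trans t u) , λ (_ , w) → ¬w (_ , ⊒-trans w t)

  ⊐-⊒-trans : T ⊐ U → U ⊒ W → T ⊐ W
  ⊐-⊒-trans ((p , t) , ¬u) (q , u) = (_ , ⊒-trans t u) , λ (_ , w) → ¬u (_ , ⊒-trans u w)

  _⊐ˢ_ : Fin (length S) → Fin (length S) → Set
  i ⊐ˢ j = lookupᴸ S i ⊐ lookupᴸ S j

  -- A strict order on a finite set is well-founded; comparing indices into `S` instead of types
  -- makes the set finite.
  ⊐ˢ-wellFounded : WellFounded (flip _⊐ˢ_)
  ⊐ˢ-wellFounded = spo-wellFounded {_≈_ = _≡_} record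
    { isEquivalence = isEquivalence
    ; irrefl        = λ { refl (t , ¬t) → ¬t t }
    ; trans         = λ t u → ⊒-⊐-trans (proj₁ u) t
    ; <-resp-≈      = resp₂ _
    }

  Represented : Type A I → Set
  Represented T = ∃[ i ] lookupᴸ S i ≃ T

  ∈⇒represented : T ∈ S → T ≃ U → Represented U
  ∈⇒represented T∈S e = index T∈S , subst (_≃ _) (lookup-index T∈S) e

  -- A variable unfolds only to a right-hand side in `S`, and an arrow of `S` has its components in
  -- `S`; so exposing an arrow never leaves the finite list.
  ∈-⇛*-⇒ : T ∈ S → T ⇛* U ⇒ V → Represented U × Represented V
  ∈-⇛*-⇒ {T = tvar i} T∈S (tvar ◅ rs)     = ∈-⇛*-⇒ T∈S rs
  ∈-⇛*-⇒ {T = tvar i} T∈S (unfold u ◅ rs) = ∈-⇛*-⇒ u rs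
  ∈-⇛*-⇒ {T = atom a} T∈S (atom ◅ rs)     = ∈-⇛*-⇒ T∈S rs
  ∈-⇛*-⇒ {T = T₁ ⇒ T₂} T∈S rs with ⇒-⇛*⁻ rs | closed T∈S
  ... | _ , _ , refl , rs₁ , rs₂ | T₁∈S , T₂∈S =
    ∈⇒represented T₁∈S (join rs₁ ε) , ∈⇒represented T₂∈S (join rs₂ ε)

  represented-⇒ : Represented T → T ≃ U ⇒ V → Represented U × Represented V
  represented-⇒ (i , e) e′ with ≃-trans e e′
  ... | join r s with ⇒-⇛*⁻ s
  ... | _ , _ , refl , s₁ , s₂ with ∈-⇛*-⇒ (∈-lookup i) r
  ... | (j , e₁) , (k , e₂) = (j , ≃-trans e₁ (join ε s₁)) , (k , ≃-trans e₂ (join ε s₂))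

  represented-⊒ : Represented T → T ⊒[ p ] W → Represented W
  represented-⊒ (i , e) (here e′)  = i , ≃-trans e e′
  represented-⊒ t       (dom e u)  = represented-⊒ (proj₁ (represented-⇒ t e)) u
  represented-⊒ t       (cod e u)  = represented-⊒ (proj₂ (represented-⇒ t e)) u

-- Strong normalization of application

module Normalization {A I : Set} (⊥ : A) (F : I → Type A I) (S : List (Type A I))
  (closed : ∀ {U V} → U ⇒ V ∈ S → U ∈ S × V ∈ S) (good : Good F) where

  open Types F S closed

  private
    variable
      Γ Γ′ : Vec (Type A I) m
      Δ Δ′ : Vec (Type A I) n
      T T′ U V : Type A I

  -- A typed stack, leading from the type of the head to that of the whole application, each arrow
  -- being exposed up to `≃`.
  data Spine {m n} (P : Type A I → Term m n → Set) :
             Type A I → Stack m n → Type A I → Set where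
    []  : T ≃ T′ → Spine P T [] T′
    _▸_∷_ : T ≃ U ⇒ V → P U N → Spine P V π T′ → Spine P T (N ∷ π) T′

  spine-map : ∀ {P Q : Type A I → Term m n → Set} →
              (∀ {U N} → P U N → Q U N) → Spine P T π T′ → Spine Q T π T′
  spine-map f ([] e)       = [] e
  spine-map f (e ▸ p ∷ ps) = e ▸ f p ∷ spine-map f ps

  spine-conv : ∀ {P : Type A I → Term m n → Set} → U ≃ T → Spine P T π T′ → Spine P U π T′
  spine-conv e ([] e′)       = [] (≃-trans e e′)
  spine-conv e (e′ ▸ p ∷ ps) = ≃-trans e e′ ▸ p ∷ ps

  spine-++ : ∀ {P : Type A I → Term m n → Set} →
             Spine P T π U → Spine P U π′ T′ → Spine P T (π ++ π′) T′
  spine-++ ([] e)       qs = spine-conv e qs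
  spine-++ (e ▸ p ∷ ps) qs = e ▸ p ∷ spine-++ ps qs

  spine-gmap : ∀ {P : Type A I → Term m n → Set} {Q : Type A I → Term m′ n′ → Set} {f} →
               (∀ {U N} → P U N → Q U (f N)) → Spine P T π T′ → Spine Q T (map f π) T′
  spine-gmap f ([] e)       = [] e
  spine-gmap f (e ▸ p ∷ ps) = e ▸ f p ∷ spine-gmap f ps

  -- Closed under head expansion, so that inductions need neither reduction
  -- lengths nor subject reduction.
  data SN {m n} (Γ : Vec (Type A I) m) (Δ : Vec (Type A I) n) : Type A I → Term m n → Set where
    ne   : ∀ x {π} → Spine (SN Γ Δ) (lookup Γ x) π T → SN Γ Δ T (var x ·* π)
    lam  : ∀ {M} → SN (U ∷ Γ) Δ V M → SN Γ Δ (U ⇒ V) (ƛ M)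
    mu   : ∀ {M} → SN Γ (U ∷ Δ) (atom ⊥) M → SN Γ Δ U (μ M)
    nam  : ∀ α {M} → SN Γ Δ (lookup Δ α) M → SN Γ Δ (atom ⊥) ([ α ] M)
    exp  : ∀ {H N C} π → H · N ↦ C → SN Γ Δ U N → SN Γ Δ T (C ·* π) → SN Γ Δ T (H · N ·* π)
    conv : ∀ {M} → U ≃ T → SN Γ Δ U M → SN Γ Δ T M

  sn⇒terminating : SN Γ Δ T M → Terminating M
  spine⇒terminating : Spine (SN Γ Δ) T π T′ → All Terminating π

  sn⇒terminating (ne x sp)       = terminating-var x (spine⇒terminating sp)
  sn⇒terminating (lam sn)        = terminating-ƛ (sn⇒terminating sn)
  sn⇒terminating (mu sn)         = terminating-μ (sn⇒terminating sn)
  sn⇒terminating (nam α sn)      = terminating-[] (sn⇒terminating sn)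
  sn⇒terminating (exp π c sn sn′) = terminating-↦ π c (sn⇒terminating sn) (sn⇒terminating sn′)
  sn⇒terminating (conv e sn)     = sn⇒terminating sn

  spine⇒terminating ([] e)         = []
  spine⇒terminating (e ▸ sn ∷ sns) = sn⇒terminating sn ∷ spine⇒terminating sns

  -- One head expansion per argument: each contraction moves an argument from the stack to the bound
  -- μ-variable, until that holds all of `π`.
  mu-·* : ∀ {M : Term m (suc n)} → Spine (SN Γ Δ) T π T′ →
          SN Γ (T′ ∷ Δ) (atom ⊥) (sub (liftμ π ids) M) → SN Γ Δ T′ (μ M ·* π)
  mu-·* {M = M} ([] e) sn = mu (subst (SN _ _ _) (trans (sub-cong liftμ-ids M) (sub-ids M)) sn)
  mu-·* {π = N ∷ π} {M = M} (e ▸ snN ∷ sp) sn = exp π βμ snN (mu-·* sp (subst (SN _ _ _) eq sn))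
    where
    eq : sub (liftμ (N ∷ π) ids) M ≡ sub (liftμ π ids) (M [ zero =′ weakenμ N ])
    eq = trans (sym (sub-liftμ-liftμ (N ∷ []) π ids M)) (cong (sub (liftμ π ids)) (sym ([0=′]≡sub M N)))

  -- Typed renamings and orthogonality

  record Ren {m n m′ n′} (Γ : Vec (Type A I) m) (Δ : Vec (Type A I) n)
             (Γ′ : Vec (Type A I) m′) (Δ′ : Vec (Type A I) n′) : Set where
    field
      onλ     : Fin m → Fin m′
      onμ     : Fin n → Fin n′
      lookupλ : ∀ x → lookup Γ′ (onλ x) ≡ lookup Γ x
      lookupμ : ∀ α → lookup Δ′ (onμ α) ≡ lookup Δ α

    on : Term m n → Term m′ n′
    on = rename onλ onμ

  open Ren

  ren-id : Ren Γ Δ Γ Δ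
  ren-id = record { onλ = id ; onμ = id ; lookupλ = λ _ → refl ; lookupμ = λ _ → refl }

  ren-∘ : ∀ {Γ″ : Vec (Type A I) m″} {Δ″ : Vec (Type A I) n″} →
          Ren Γ′ Δ′ Γ″ Δ″ → Ren Γ Δ Γ′ Δ′ → Ren Γ Δ Γ″ Δ″
  ren-∘ s r = record
    { onλ     = onλ s ∘ onλ r
    ; onμ     = onμ s ∘ onμ r
    ; lookupλ = λ x → trans (lookupλ s (onλ r x)) (lookupλ r x)
    ; lookupμ = λ α → trans (lookupμ s (onμ r α)) (lookupμ r α)
    }

  ren-λ : Ren Γ Δ (U ∷ Γ) Δ
  ren-λ = record { onλ = suc ; onμ = id ; lookupλ = λ _ → refl ; lookupμ = λ _ → refl }

  ren-μ : Ren Γ Δ Γ (U ∷ Δ)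
  ren-μ = record { onλ = id ; onμ = suc ; lookupλ = λ _ → refl ; lookupμ = λ _ → refl }

  TermPred : Set₁
  TermPred = ∀ {m n} → Vec (Type A I) m → Vec (Type A I) n → Type A I → Term m n → Set

  StackPred : Set₁
  StackPred = ∀ {m n} → Vec (Type A I) m → Vec (Type A I) n → Type A I → Stack m n → Type A I → Set

  -- Orthogonality in Kripke style: quantifying over renamings makes it stable under passing below
  -- binders, where stacks may mention new variables.
  record Orth (K : StackPred) {m n} (Γ : Vec (Type A I) m) (Δ : Vec (Type A I) n)
              (U : Type A I) (M : Term m n) : Set where
    constructor orth
    field
      run : ∀ {m′ n′} {Γ′ : Vec _ m′} {Δ′ : Vec _ n′} {π T} (r : Ren Γ Δ Γ′ Δ′) →
            K Γ′ Δ′ U π T → SN Γ′ Δ′ T (on r M ·* π)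

  open Orth

  orth-ren : ∀ {K : StackPred} (r : Ren Γ Δ Γ′ Δ′) →
             Orth K Γ Δ U M → Orth K Γ′ Δ′ U (on r M)
  run (orth-ren {M = M} r o) {π = π} s k =
    subst (λ M → SN _ _ _ (M ·* π)) (sym (rename-rename (onλ s) (onμ s) (onλ r) (onμ r) M))
      (run o (ren-∘ s r) k)

  orth-·* : ∀ {K : StackPred} → Orth K Γ Δ U M → K Γ Δ U π T → SN Γ Δ T (M ·* π)
  orth-·* {M = M} {π = π} o k = subst (λ M → SN _ _ _ (M ·* π)) (rename-id M) (run o ren-id k)

  -- What λ-variables may be replaced by (Value) and what stacks μ-variables
  -- may be applied to (Cont) while preserving SN.
  record Model : Set₁ where
    field
      Value      : TermPred
      Cont       : StackPred
      value-ren  : (r : Ren Γ Δ Γ′ Δ′) → Value Γ Δ U M → Value Γ′ Δ′ U (on r M)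
      value-var  : ∀ x → Value Γ Δ (lookup Γ x) (var x)
      value-conv : U ≃ T → Value Γ Δ U M → Value Γ Δ T M
      value-app  : Value Γ Δ U M → Spine (Orth Cont Γ Δ) U π T → Cont Γ Δ T π′ T′ →
                   SN Γ Δ T′ (M ·* (π ++ π′))
      cont-ren   : (r : Ren Γ Δ Γ′ Δ′) → Cont Γ Δ T π T′ → Cont Γ′ Δ′ T (map (on r) π) T′
      cont-[]    : T ≃ T′ → Cont Γ Δ T [] T′
      cont-conv  : U ≃ T → Cont Γ Δ T π T′ → Cont Γ Δ U π T′
      cont-sn    : Cont Γ Δ T π T′ → Spine (SN Γ Δ) T π T′
      cont-∷⁻    : Cont Γ Δ (U ⇒ V) (N ∷ π) T′ → Value Γ Δ U N × Cont Γ Δ V π T′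

  -- The substitution lemma for an arbitrary model

  module Fundamental (𝓜 : Model) where
    open Model 𝓜

    record Env {m n m′ n′} (Γ : Vec (Type A I) m) (Δ : Vec (Type A I) n)
               (Γ′ : Vec (Type A I) m′) (Δ′ : Vec (Type A I) n′) (σ : Sub m n m′ n′) : Set where
      field
        value : ∀ x → Value Γ′ Δ′ (lookup Γ x) (term σ x)
        stack : ∀ α → Cont Γ′ Δ′ (lookup Δ α) (proj₂ (cont σ α)) (lookup Δ′ (proj₁ (cont σ α)))

    open Env

    env-ren : ∀ {Γ″ : Vec (Type A I) m″} {Δ″ : Vec (Type A I) n″} (r : Ren Γ′ Δ′ Γ″ Δ″) →
              Env Γ Δ Γ′ Δ′ σ → Env Γ Δ Γ″ Δ″ (renameSub (onλ r) (onμ r) σ)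
    value (env-ren r ρ) x = value-ren r (value ρ x)
    stack (env-ren r ρ) α = subst (Cont _ _ _ _) (sym (lookupμ r _)) (cont-ren r (stack ρ α))

    env-ids : Env Γ Δ Γ Δ ids
    value env-ids x = value-var x
    stack env-ids α = cont-[] ≃-refl

    env-◂ : Value Γ′ Δ′ U N → Env Γ Δ Γ′ Δ′ σ → Env (U ∷ Γ) Δ Γ′ Δ′ (N ◂ σ)
    value (env-◂ v ρ) zero    = v
    value (env-◂ v ρ) (suc x) = value ρ x
    stack (env-◂ v ρ)         = stack ρ

    env-λ : Env Γ Δ Γ′ Δ′ σ → Env (U ∷ Γ) Δ (U ∷ Γ′) Δ′ (liftλ σ)
    value (env-λ ρ) zero    = value-var zero
    value (env-λ ρ) (suc x) = value-ren ren-λ (value ρ x)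
    stack (env-λ ρ) α       = cont-ren ren-λ (stack ρ α)

    env-μ : Cont Γ′ Δ′ T π T′ → Env Γ Δ Γ′ Δ′ σ → Env Γ (T ∷ Δ) Γ′ (T′ ∷ Δ′) (liftμ π σ)
    value (env-μ k ρ) x       = value-ren ren-μ (value ρ x)
    stack (env-μ k ρ) zero    = cont-ren ren-μ k
    stack (env-μ k ρ) (suc α) = cont-ren ren-μ (stack ρ α)

    -- Structural induction on the `SN` derivation. The trailing stack is there because `nam`
    -- applies its body to the stack of a μ-variable; `lam` consumes it and `mu` hands it to the
    -- bound variable.
    sn-sub-·* : ∀ {M : Term m n} {π : Stack m′ n′} → SN Γ Δ T M → Env Γ Δ Γ′ Δ′ σ →
                Cont Γ′ Δ′ T π T′ → SN Γ′ Δ′ T′ (sub σ M ·* π)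
    sn-sub : ∀ {M : Term m n} → SN Γ Δ T M → Env Γ Δ Γ′ Δ′ σ → SN Γ′ Δ′ T (sub σ M)
    spine-sub : Spine (SN Γ Δ) T π T′ → Env Γ Δ Γ′ Δ′ σ →
                Spine (Orth Cont Γ′ Δ′) T (map (sub σ) π) T′

    sn-sub-·* {σ = σ} {π = π′} (ne x {π} sp) ρ k =
      subst (SN _ _ _) eq (value-app (value ρ x) (spine-sub sp ρ) k)
      where
      eq : term σ x ·* (map (sub σ) π ++ π′) ≡ sub σ (var x ·* π) ·* π′
      eq = trans (·*-++ (term σ x) (map (sub σ) π) π′) (cong (_·* π′) (sym (sub-·* σ (var x) π)))
    sn-sub-·* {π = []} (lam sn) ρ k with cont-sn k
    ... | [] e = conv e (lam (sn-sub sn (env-λ ρ)))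
    sn-sub-·* {σ = σ} {π = N ∷ π} (lam {M = M} sn) ρ k with cont-sn k | cont-∷⁻ k
    ... | _ ▸ snN ∷ _ | v , k′ = exp π βλ snN
      (subst (λ M → SN _ _ _ (M ·* π)) (sym (sub-◂ σ N M)) (sn-sub-·* sn (env-◂ v ρ) k′))
    sn-sub-·* {σ = σ} {π = π} (mu {M = M} sn) ρ k =
      mu-·* (cont-sn k) (subst (SN _ _ _) (sym (sub-liftμ-liftμ [] π σ M)) (sn-sub sn (env-μ k ρ)))
    sn-sub-·* (nam α sn) ρ k with cont-sn k
    ... | [] e      = conv e (nam _ (sn-sub-·* sn ρ (stack ρ α)))
    -- A named term has an atomic type, so no argument can follow it.
    ... | e ▸ _ ∷ _ = ⊥-elim (atom≄⇒ e)
    sn-sub-·* {σ = σ} {π = π′} (exp {H = H} {N} {C} π c snN sn) ρ k =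
      subst (SN _ _ _) (eq (H · N))
        (exp (map (sub σ) π ++ π′) (sub-↦ σ c) (sn-sub snN ρ)
             (subst (SN _ _ _) (sym (eq C)) (sn-sub-·* sn ρ k)))
      where
      eq : ∀ M → sub σ M ·* (map (sub σ) π ++ π′) ≡ sub σ (M ·* π) ·* π′
      eq M = trans (·*-++ (sub σ M) (map (sub σ) π) π′) (cong (_·* π′) (sym (sub-·* σ M π)))
    sn-sub-·* (conv e sn) ρ k = sn-sub-·* sn ρ (cont-conv e k)

    sn-sub sn ρ = sn-sub-·* sn ρ (cont-[] ≃-refl)

    spine-sub ([] e) ρ = [] e
    spine-sub {π = N ∷ π} {σ = σ} (e ▸ sn ∷ sp) ρ =
      -- The induction hypothesis for an argument holds in every renamed environment and with every
      -- continuation, which is orthogonality.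
      e ▸ orth (λ {_} {_} {_} {_} {π′} r k →
                 subst (λ M → SN _ _ _ (M ·* π′)) (sym (rename-sub (onλ r) (onμ r) σ N))
                   (sn-sub-·* sn (env-ren r ρ) k))
        ∷ spine-sub sp ρ

  -- First model: reducible terms

  SpineSN : StackPred
  SpineSN Γ Δ = Spine (SN Γ Δ)

  spineSN-ren : ∀ (r : Ren Γ Δ Γ′ Δ′) x → SpineSN Γ′ Δ′ (lookup Γ x) π T →
                SpineSN Γ′ Δ′ (lookup Γ′ (onλ r x)) π T
  spineSN-ren r x = subst (λ U → SpineSN _ _ U _ _) (sym (lookupλ r x))

  Red : TermPred
  Red = Orth SpineSN

  red-conv : U ≃ T → Red Γ Δ U M → Red Γ Δ T M
  run (red-conv e o) r sp = run o r (spine-conv e sp)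

  red⇒sn : Red Γ Δ U M → SN Γ Δ U M
  red⇒sn f = orth-·* f ([] ≃-refl)

  redModel : Model
  redModel = record
    { Value      = Red
    ; Cont       = λ Γ Δ → Spine (Red Γ Δ)
    ; value-ren  = orth-ren
    ; value-var  = λ x → orth λ r sp → ne (onλ r x) (spineSN-ren r x sp)
    ; value-conv = red-conv
    ; value-app  = λ v sp k → orth-·* v
        (spine-++ (spine-map (λ o → orth-·* o ([] ≃-refl)) sp) (spine-map red⇒sn k))
    ; cont-ren   = λ r → spine-gmap (orth-ren r)
    ; cont-[]    = []
    ; cont-conv  = spine-conv
    ; cont-sn    = spine-map red⇒sn
    ; cont-∷⁻    = λ { (e ▸ v ∷ k) → let e₁ , e₂ = ⇒-injective e in
                       red-conv (≃-sym e₁) v , spine-conv e₂ k }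
    }

  module RedF = Fundamental redModel

  -- Renaming is the substitution lemma for the renamed identity environment, whose values, being
  -- variables, are reducible.
  sn-ren : ∀ {M : Term m n} (r : Ren Γ Δ Γ′ Δ′) → SN Γ Δ T M → SN Γ′ Δ′ T (on r M)
  sn-ren {M = M} r sn = subst (SN _ _ _)
    (trans (sym (rename-sub (onλ r) (onμ r) ids M)) (cong (on r) (sub-ids M)))
    (RedF.sn-sub sn (RedF.env-ren r RedF.env-ids))

  sn-·*-red : ∀ {π : Stack m n} → SN Γ Δ T M → Spine (Red Γ Δ) T π T′ → SN Γ Δ T′ (M ·* π)
  sn-·*-red {M = M} {π = π} sn sp =
    subst (λ M → SN _ _ _ (M ·* π)) (sub-ids M) (RedF.sn-sub-·* sn RedF.env-ids sp)

  Applicative : Type A I → Set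
  Applicative T = ∀ {m n} {Γ : Vec (Type A I) m} {Δ : Vec (Type A I) n} {M} →
                  SN Γ Δ T M → Red Γ Δ T M

  -- Second model: values and continuations polarized by a type

  module _ (R : Type A I) (below : ∀ {T} → R ⊐ T → Applicative T) where

    -- Variables count at every type, so that an environment may leave them in place; other terms
    -- count only at types negative in `R`. The empty stack plays the dual part in `PosCont`.
    data NegValue {m n} (Γ : Vec (Type A I) m) (Δ : Vec (Type A I) n) (U : Type A I) :
                  Term m n → Set where
      var : ∀ x → lookup Γ x ≃ U → NegValue Γ Δ U (var x)
      neg : ∀ {M} → R ⊒[ 1ℙ ] U → SN Γ Δ U M → NegValue Γ Δ U M

    data PosCont {m n} (Γ : Vec (Type A I) m) (Δ : Vec (Type A I) n) (T : Type A I) :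
                 Stack m n → Type A I → Set where
      []  : T ≃ T′ → PosCont Γ Δ T [] T′
      pos : ∀ {π} → R ⊒[ 0ℙ ] T → SpineSN Γ Δ T π T′ → PosCont Γ Δ T π T′

    posCont⇒spine : PosCont Γ Δ T π T′ → SpineSN Γ Δ T π T′
    posCont⇒spine ([] e)     = [] e
    posCont⇒spine (pos _ sp) = sp

    -- Domains of a negative type are positive, and there every strongly normalizing stack is a
    -- continuation, so orthogonality to `PosCont` yields reducibility. Codomains stay negative.
    neg-spine : R ⊒[ 1ℙ ] U → Spine (Orth PosCont Γ Δ) U π T →
                Spine (Red Γ Δ) U π T × R ⊒[ 1ℙ ] T
    neg-spine t ([] e) = [] e , ⊒-trans t (here e)
    neg-spine t (e ▸ f ∷ sp) =
      let sp′ , t′ = neg-spine (⊒-trans t (cod e (here ≃-refl))) sp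
      in e ▸ orth (λ r sp → run f r (pos (⊒-trans t (dom e (here ≃-refl))) sp)) ∷ sp′ , t′

    below-spine : R ⊐ T → SpineSN Γ Δ T π T′ → Spine (Red Γ Δ) T π T′
    below-spine l ([] e)        = [] e
    below-spine l (e ▸ sn ∷ sp) =
      e ▸ below (⊐-⊒-trans l (1ℙ , dom e (here ≃-refl))) sn
        ∷ below-spine (⊐-⊒-trans l (0ℙ , cod e (here ≃-refl))) sp

    -- A path back from `T` to `R`, preceded by the given path of opposite parity, would close an
    -- odd cycle.
    pos-neg⇒⊐ : R ⊒[ 0ℙ ] T → R ⊒[ 1ℙ ] T → R ⊐ T
    pos-neg⇒⊐ p n = (0ℙ , p) , λ where
      (0ℙ , t) → ⊒-no-odd-cycle good R (⊒-trans n t)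
      (1ℙ , t) → ⊒-no-odd-cycle good R (⊒-trans p t)

    neg-app : NegValue Γ Δ U M → Spine (Orth PosCont Γ Δ) U π T → PosCont Γ Δ T π′ T′ →
              SN Γ Δ T′ (M ·* (π ++ π′))
    neg-app (var x e) sp k = ne x (spine-conv e
      (spine-++ (spine-map (λ o → orth-·* o ([] ≃-refl)) sp) (posCont⇒spine k)))
    neg-app (neg n sn) sp k = let sp′ , n′ = neg-spine n sp in
      sn-·*-red sn (spine-++ sp′ (go n′ k))
      where
      go : R ⊒[ 1ℙ ] T → PosCont Γ Δ T π T′ → Spine (Red Γ Δ) T π T′
      go n ([] e)     = [] e
      -- Here `T` is both positive and negative, hence strictly below `R`, and `below` makes the
      -- remaining arguments reducible.
      go n (pos p sp) = below-spine (pos-neg⇒⊐ p n) sp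

    polarModel : Model
    polarModel = record
      { Value      = NegValue
      ; Cont       = PosCont
      ; value-ren  = λ where
          r (var x e)  → var (onλ r x) (subst (_≃ _) (sym (lookupλ r x)) e)
          r (neg n sn) → neg n (sn-ren r sn)
      ; value-var  = λ x → var x ≃-refl
      ; value-conv = λ where
          e (var x e′)  → var x (≃-trans e′ e)
          e (neg n sn) → neg (⊒-trans n (here e)) (conv e sn)
      ; value-app  = neg-app
      ; cont-ren   = λ where
          r ([] e)     → [] e
          r (pos p sp) → pos p (spine-gmap (sn-ren r) sp)
      ; cont-[]    = []
      ; cont-conv  = λ where
          e ([] e′)    → [] (≃-trans e e′)
          e (pos p sp) → pos (⊒-trans p (here (≃-sym e))) (spine-conv e sp)
      ; cont-sn    = posCont⇒spine
      ; cont-∷⁻    = λ { (pos p (e ▸ sn ∷ sp)) → let e₁ , e₂ = ⇒-injective e in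
                         neg (⊒-trans p (dom ≃-refl (here ≃-refl))) (conv (≃-sym e₁) sn) ,
                         pos (⊒-trans p (cod ≃-refl (here ≃-refl))) (spine-conv e₂ sp) }
      }

    applicative-step : Applicative R
    run (applicative-step {M = M} sn) {π = π} r sp =
      subst (λ M → SN _ _ _ (M ·* π)) (sub-ids (on r M))
        -- The empty path makes `R` positive in itself, so every strongly normalizing stack is an
        -- admissible continuation.
        (PolarF.sn-sub-·* (sn-ren r sn) PolarF.env-ids (pos (here ≃-refl) sp))
      where module PolarF = Fundamental polarModel

  applicative-conv : U ≃ T → Applicative U → Applicative T
  applicative-conv e f sn = red-conv e (f (conv (≃-sym e) sn))

  -- Well-founded induction on indices: a type strictly below an entry of `S` is reachable from it,
  -- hence represented by a smaller index.
  applicative : Represented T → Applicative T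
  applicative (i , e) = applicative-conv e (go i (⊐ˢ-wellFounded i))
    where
    go : ∀ i → Acc (flip _⊐ˢ_) i → Applicative (lookupᴸ S i)
    go i (acc a) = applicative-step (lookupᴸ S i) λ {T} l →
      let j , e = represented-⊒ (i , ≃-refl) (proj₂ (proj₁ l))
      in applicative-conv e (go j (a (⊐-⊒-trans l (0ℙ , here (≃-sym e)))))

-- Typable terms

terminating⇒stronglyNormalizing : {M : Term m n} → Terminating M → StronglyNormalizing M
terminating⇒stronglyNormalizing (acc a) (f , refl , f▷) =
  terminating⇒stronglyNormalizing (a (f▷ 0)) (f ∘ suc , refl , f▷ ∘ suc)

-- Finite lists of types closed under components

module _ {A I : Set} where

  subterms : Type A I → List (Type A I)
  subterms (atom a) = atom a ∷ []
  subterms (tvar i) = tvar i ∷ []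
  subterms (U ⇒ V)  = U ⇒ V ∷ subterms U ++ subterms V

  self∈subterms : ∀ T → T ∈ subterms T
  self∈subterms (atom a) = here refl
  self∈subterms (tvar i) = here refl
  self∈subterms (U ⇒ V)  = here refl

  subterms-⇒ : ∀ {U V} T → U ⇒ V ∈ subterms T → U ∈ subterms T × V ∈ subterms T
  subterms-⇒ (atom a) (here ())
  subterms-⇒ (tvar i) (here ())
  subterms-⇒ (U ⇒ V)  (here refl) =
    there (∈-++⁺ˡ (self∈subterms U)) , there (∈-++⁺ʳ (subterms U) (self∈subterms V))
  subterms-⇒ (U ⇒ V)  (there t) with ∈-++⁻ (subterms U) t
  ... | inj₁ u = let p , q = subterms-⇒ U u in there (∈-++⁺ˡ p) , there (∈-++⁺ˡ q)
  ... | inj₂ v = let p , q = subterms-⇒ V v in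
                 there (∈-++⁺ʳ (subterms U) p) , there (∈-++⁺ʳ (subterms U) q)

  closure : List (Type A I) → List (Type A I)
  closure = concatMap subterms

  ⊆-closure : ∀ Ts → Ts ⊆ closure Ts
  ⊆-closure Ts t = ∈-concatMap⁺ subterms (Any.map (λ { refl → self∈subterms _ }) t)

  closure-⇒ : ∀ {U V} Ts → U ⇒ V ∈ closure Ts → U ∈ closure Ts × V ∈ closure Ts
  closure-⇒ Ts t =
    let t′ = Any.map (subterms-⇒ _) (∈-concatMap⁻ subterms {xs = Ts} t) in
    ∈-concatMap⁺ subterms (Any.map proj₁ t′) , ∈-concatMap⁺ subterms (Any.map proj₂ t′)

-- The types relevant to a typing derivation

module _ {A I : Set} (⊥ : A) (F : I → Type A I) where
  open Typing ⊥ F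

  private
    variable
      Γ   : Vec (Type A I) m
      Δ   : Vec (Type A I) n
      T U V : Type A I

  equations : F ⊢ U ≈ V → List (Type A I)
  equations (≈-eqn i)     = F i ∷ []
  equations ≈-refl        = []
  equations (≈-sym e)     = equations e
  equations (≈-trans d e) = equations d ++ equations e
  equations (≈-⇒ d e)     = equations d ++ equations e

  -- Besides the equations used in conversions, this collects the function types of applications, at
  -- which `applicative` is invoked. The list is finite even if `I` is not.
  relevant : Γ ∣ Δ ⊢ M ∶ T → List (Type A I)
  relevant (ax x)                   = []
  relevant (≈ d e)                  = relevant d ++ equations e
  relevant (→i d)                   = relevant d
  relevant (→e {U = U} {V = V} d e) = U ⇒ V ∷ relevant d ++ relevant e
  relevant (⊥e d)                   = relevant d
  relevant (⊥i α d)                 = relevant d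

  module _ (good : Good F) (Ts : List (Type A I)) where
    open Types F (closure Ts) (closure-⇒ Ts)
    open Normalization ⊥ F (closure Ts) (closure-⇒ Ts) good

    ≈⇒≃ : (e : F ⊢ U ≈ V) → equations e ⊆ Ts → U ≃ V
    ≈⇒≃ (≈-eqn i)     s = ≃-unfold (⊆-closure Ts (s (here refl)))
    ≈⇒≃ ≈-refl        s = ≃-refl
    ≈⇒≃ (≈-sym e)     s = ≃-sym (≈⇒≃ e s)
    ≈⇒≃ (≈-trans d e) s = ≃-trans (≈⇒≃ d (s ∘ ∈-++⁺ˡ)) (≈⇒≃ e (s ∘ ∈-++⁺ʳ (equations d)))
    ≈⇒≃ (≈-⇒ d e)     s = ≃-⇒ (≈⇒≃ d (s ∘ ∈-++⁺ˡ)) (≈⇒≃ e (s ∘ ∈-++⁺ʳ (equations d)))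

    -- `Ts` is fixed and merely contains the relevant types, so that all subderivations are read
    -- modulo the same congruence.
    typable⇒sn : (d : Γ ∣ Δ ⊢ M ∶ T) → relevant d ⊆ Ts → SN Γ Δ T M
    typable⇒sn (ax x)   s = ne x ([] ≃-refl)
    typable⇒sn (≈ d e)  s = conv (≈⇒≃ e (s ∘ ∈-++⁺ʳ (relevant d))) (typable⇒sn d (s ∘ ∈-++⁺ˡ))
    typable⇒sn (→i d)   s = lam (typable⇒sn d s)
    typable⇒sn (→e d e) s =
      orth-·* (applicative (∈⇒represented (⊆-closure Ts (s (here refl))) ≃-refl)
                           (typable⇒sn d (s ∘ there ∘ ∈-++⁺ˡ)))
              (≃-refl ▸ typable⇒sn e (s ∘ there ∘ ∈-++⁺ʳ (relevant d)) ∷ [] ≃-refl)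
    typable⇒sn (⊥e d)   s = mu (typable⇒sn d s)
    typable⇒sn (⊥i α d) s = nam α (typable⇒sn d s)

    typable⇒terminating : (d : Γ ∣ Δ ⊢ M ∶ T) → relevant d ⊆ Ts → Terminating M
    typable⇒terminating d s = sn⇒terminating (typable⇒sn d s)

mainTheorem2 : (A I : Set) (⊥ : A) (F : I → Type A I) → Good F →
    let open Typing ⊥ F in
    ∀ {m n : ℕ} {Γ : Vec (Type A I) m} {Δ : Vec (Type A I) n} {M : Term m n} {T : Type A I} →
    Γ ∣ Δ ⊢ M ∶ T → StronglyNormalizing M
mainTheorem2 A I ⊥ F good d =
  terminating⇒stronglyNormalizing (typable⇒terminating ⊥ F good (relevant ⊥ F d) d id)
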